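{- Fix an integer $k\ge 2$. For each $n\in\mathbb{N}$, let $J_{k,n}$ be the number of subsets of $\{1,2,\ldots,n\}$ that (1) satisfy the $k$-Zeckendorf condition, (2) contain $n$, and (3) are maximal. Then $$J_{k,n}=\begin{cases}1, & \text{if } n=1;\\ 0, & \text{if } 2\le n\le k+1;\\ 1, & \text{if } k+1<n\le 2k+2;\\ J_{k,n-1}+J_{k,n-(k+1)}, & \text{if } n>2k+2.\end{cases}$$
   Context: $\mathbb{N}=\{1,2,3,\ldots\}$. A nonempty finite set $S\subseteq\mathbb{N}$ is maximal if $\min S=|S|$ (this is a cardinality condition, not maximality under inclusion). A finite set of natural numbers satisfies the $k$-Zeckendorf condition if any two distinct numbers in the set are at least $k$ apart (singletons satisfy this vacuously). -}

module Defs where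

open import Data.Bool.Base using (true; false)
open import Data.Empty using (⊥)
open import Data.Fin.Base using (Fin; toℕ)
import Data.Fin.Properties as Fin
open import Data.Fin.Subset using (Subset; _∈_; ∣_∣; inside; outside)
open import Data.Fin.Subset.Properties using (_∈?_)
open import Data.List.Base using (List; []; _∷_; _++_; map; filter; length)
open import Data.List.Membership.Propositional using () renaming (_∈_ to _∈ₗ_)
open import Data.List.Membership.Propositional.Properties
  using (∈-map⁺; ∈-map⁻; ∈-++⁺ˡ; ∈-++⁺ʳ)
open import Data.List.Relation.Unary.Any using (here)
open import Data.List.Relation.Unary.All using ([])
open import Data.List.Relation.Unary.AllPairs using ([]; _∷_)
open import Data.List.Relation.Unary.Unique.Propositional using (Unique)
open import Data.List.Relation.Unary.Unique.Propositional.Properties using (map⁺; ++⁺)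
open import Data.Nat.Base using (ℕ; zero; suc; _≤_; ∣_-_∣)
open import Data.Nat.Properties using (_≟_; _≤?_)
open import Data.Product.Base using (∃; _×_; _,_)
open import Data.Vec.Base using ([]; _∷_)
open import Data.Vec.Properties using (∷-injectiveʳ)
open import Relation.Binary.PropositionalEquality using (_≡_; _≢_; refl)
open import Relation.Nullary using (Dec)
open import Relation.Nullary.Decidable using (¬?; _×-dec_; _→-dec_)

-- A `Subset n` stands for a subset of {1, …, n}: the index i : Fin n
-- represents the number 1 + toℕ i.
num : ∀ {n} → Fin n → ℕ
num i = suc (toℕ i)

Contains : ∀ {n} → ℕ → Subset n → Set
Contains m S = ∃ λ i → i ∈ S × num i ≡ m

IsMin : ∀ {n} → Fin n → Subset n → Set
IsMin i S = i ∈ S × (∀ j → j ∈ S → num i ≤ num j)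

-- min S = |S|; the existence of a minimum makes S nonempty.
Maximal : ∀ {n} → Subset n → Set
Maximal S = ∃ λ i → IsMin i S × num i ≡ ∣ S ∣

Zeckendorf : ∀ {n} → ℕ → Subset n → Set
Zeckendorf k S = ∀ i j → i ∈ S → j ∈ S → i ≢ j → k ≤ ∣ num i - num j ∣

Counted : ∀ k n → Subset n → Set
Counted k n S = Zeckendorf k S × Contains n S × Maximal S

contains? : ∀ {n} m (S : Subset n) → Dec (Contains m S)
contains? m S = Fin.any? λ i → (i ∈? S) ×-dec (num i ≟ m)

isMin? : ∀ {n} (i : Fin n) (S : Subset n) → Dec (IsMin i S)
isMin? i S = (i ∈? S) ×-dec Fin.all? λ j → (j ∈? S) →-dec (num i ≤? num j)

maximal? : ∀ {n} (S : Subset n) → Dec (Maximal S)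
maximal? S = Fin.any? λ i → isMin? i S ×-dec (num i ≟ ∣ S ∣)

zeckendorf? : ∀ {n} k (S : Subset n) → Dec (Zeckendorf k S)
zeckendorf? k S = Fin.all? λ i → Fin.all? λ j →
  (i ∈? S) →-dec ((j ∈? S) →-dec (¬? (i Fin.≟ j) →-dec (k ≤? ∣ num i - num j ∣)))

counted? : ∀ k n (S : Subset n) → Dec (Counted k n S)
counted? k n S = zeckendorf? k S ×-dec (contains? n S ×-dec maximal? S)

subsets : ∀ n → List (Subset n)
subsets zero    = [] ∷ []
subsets (suc n) = map (outside ∷_) (subsets n) ++ map (inside ∷_) (subsets n)

subsets-complete : ∀ {n} (S : Subset n) → S ∈ₗ subsets n
subsets-complete []          = here refl
subsets-complete (false ∷ S) = ∈-++⁺ˡ (∈-map⁺ (outside ∷_) (subsets-complete S))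
subsets-complete {suc n} (true ∷ S) =
  ∈-++⁺ʳ (map (outside ∷_) (subsets n)) (∈-map⁺ (inside ∷_) (subsets-complete S))

subsets-unique : ∀ n → Unique (subsets n)
subsets-unique zero    = [] ∷ []
subsets-unique (suc n) =
  ++⁺ (map⁺ ∷-injectiveʳ (subsets-unique n)) (map⁺ ∷-injectiveʳ (subsets-unique n))
    λ (S∈out , S∈in) → disjoint S∈out S∈in
  where
  disjoint : ∀ {S} → S ∈ₗ map (outside ∷_) (subsets n) →
             S ∈ₗ map (inside ∷_) (subsets n) → ⊥
  disjoint p q with ∈-map⁻ (outside ∷_) p | ∈-map⁻ (inside ∷_) q
  ... | _ , _ , refl | _ , _ , ()

-- `subsets n` lists each subset exactly once, so this length is a cardinality.
J : ℕ → ℕ → ℕ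
J k n = length (filter (counted? k n) (subsets n))

{-# OPTIONS --safe #-}
-- Read a subset of {1, …, n} from 1 upwards. After z absent numbers the minimum
-- must be z + 1, and z further elements have to follow with gaps at least k, the
-- last one being n. Splitting on the gap between the two smallest elements a < b
-- gives the recurrence: a gap greater than k can be shortened by one (leaving a
-- set counted by J k (n - 1)), while for a gap equal to k, deleting a and shifting
-- the rest down by k + 1 leaves a set of one element less with minimum a - 1
-- (counted by J k (n - (k + 1))).
module Submission where

open import Defs
open import Algebra.Properties.CommutativeSemigroup using (interchange)
open import Data.Fin.Base using (toℕ; zero; suc)
import Data.Fin.Properties as Fin
open import Data.Fin.Subset using (Subset; _∈_; ∣_∣; inside; outside)
open import Data.Fin.Subset.Properties using (_∈?_; x∈p⇒∣p-x∣<∣p∣)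
open import Data.List.Base using ([]; _∷_; _++_; map; filter; length)
open import Data.List.Properties
  using (filter-++; filter-≐; filter-all; filter-none; length-++)
open import Data.List.Relation.Unary.All as All using ([]; _∷_)
open import Data.Nat.Base
  using (ℕ; zero; suc; pred; _+_; _*_; _∸_; _≤_; _<_; z≤n; s≤s; s≤s⁻¹)
open import Data.Nat.Properties
  using (_≟_; _≤?_; +-comm; +-identityʳ; +-suc; suc-injective; ≤-trans; ≤-reflexive;
         ≤-<-trans; n≤1+n; m≤m+n; m+n∸m≡n; m+[n∸m]≡n; +-mono-≤; +-cancelˡ-≤;
         pred-mono-≤; +-commutativeSemigroup)
open import Data.Nat.Solver using (module +-*-Solver)
open import Data.Product.Base using (_×_; _,_; ∃)
open import Data.Vec.Base using ([]; _∷_; here; there)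
open import Function.Base using (_∘_; id)
open import Level using (0ℓ)
open import Relation.Binary.PropositionalEquality
  using (_≡_; refl; sym; trans; cong; cong₂; subst; module ≡-Reasoning)
open import Relation.Nullary using (¬_; yes; no; contradiction)
open import Relation.Nullary.Decidable using (_×-dec_; _→-dec_)
open import Relation.Unary using (Pred; Decidable; _≐_)

private variable
  n : ℕ
  P Q : Pred (Subset n) 0ℓ

-- Counting subsets by membership of the first number.

length-filter-map : ∀ {a b p} {A : Set a} {B : Set b} {P : Pred B p}
                    (P? : Decidable P) (f : A → B) xs →
                    length (filter P? (map f xs)) ≡ length (filter (P? ∘ f) xs)
length-filter-map P? f []       = refl
length-filter-map P? f (x ∷ xs) with P? (f x)
... | yes _ = cong suc (length-filter-map P? f xs)
... | no _  = length-filter-map P? f xs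

count : Decidable {A = Subset n} P → ℕ
count {n = n} P? = length (filter P? (subsets n))

count-cong : (P? : Decidable {A = Subset n} P) (Q? : Decidable Q) → P ≐ Q →
             count P? ≡ count Q?
count-cong {n = n} P? Q? P≐Q = cong length (filter-≐ P? Q? P≐Q (subsets n))

count-none : (P? : Decidable {A = Subset n} P) → (∀ S → ¬ P S) → count P? ≡ 0
count-none {n = n} P? ¬P =
  cong length (filter-none P? (All.universal ¬P (subsets n)))

count-∷ : (P? : Decidable {A = Subset (suc n)} P) →
          count P? ≡ count (P? ∘ (outside ∷_)) + count (P? ∘ (inside ∷_))
count-∷ {n = n} P? = begin
  length (filter P? (outs ++ ins))
    ≡⟨ cong length (filter-++ P? outs ins) ⟩
  length (filter P? outs ++ filter P? ins)
    ≡⟨ length-++ (filter P? outs) ⟩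
  length (filter P? outs) + length (filter P? ins)
    ≡⟨ cong₂ _+_ (length-filter-map P? (outside ∷_) (subsets n))
                   (length-filter-map P? (inside ∷_) (subsets n)) ⟩
  count (P? ∘ (outside ∷_)) + count (P? ∘ (inside ∷_)) ∎
  where
  open ≡-Reasoning
  outs = map (outside ∷_) (subsets n)
  ins  = map (inside ∷_) (subsets n)

-- How the conditions change when one number is read.

AtLeast : ℕ → Subset n → Set
AtLeast c S = ∀ i → i ∈ S → c ≤ toℕ i

atLeast? : ∀ c → Decidable (AtLeast {n} c)
atLeast? c S = Fin.all? λ i → (i ∈? S) →-dec (c ≤? toℕ i)

-- `pred` fixes 0, so one statement covers both a forced absence, which uses up one unit of `c`, and
-- a free one.
AtLeast-outside⁺ : ∀ {c} {S : Subset n} → AtLeast (pred c) S → AtLeast c (outside ∷ S)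
AtLeast-outside⁺ {c = zero}  p i       _         = z≤n
AtLeast-outside⁺ {c = suc c} p (suc i) (there q) = s≤s (p i q)

AtLeast-outside⁻ : ∀ {c} {S : Subset n} → AtLeast c (outside ∷ S) → AtLeast (pred c) S
AtLeast-outside⁻ p i q = pred-mono-≤ (p (suc i) (there q))

Zeckendorf-tail : ∀ {k b} {S : Subset n} → Zeckendorf k (b ∷ S) → Zeckendorf k S
Zeckendorf-tail z i j p q i≢j =
  z (suc i) (suc j) (there p) (there q) (i≢j ∘ Fin.suc-injective)

Zeckendorf-outside : ∀ {k} {S : Subset n} → Zeckendorf k S → Zeckendorf k (outside ∷ S)
Zeckendorf-outside z (suc i) (suc j) (there p) (there q) i≢j =
  z i j p q (i≢j ∘ cong suc)

module _ {g : ℕ} {S : Subset n} where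

  -- An element of `S` with index `j` lies `suc (toℕ j)` beyond the new head, so a gap of at least
  -- `suc g` after the head amounts to `g` absent numbers. This is why k is written as `suc g`.
  Zeckendorf-inside : Zeckendorf (suc g) S → AtLeast g S → Zeckendorf (suc g) (inside ∷ S)
  Zeckendorf-inside z a zero    zero    _         _         i≢j = contradiction refl i≢j
  Zeckendorf-inside z a zero    (suc j) _         (there q) _   = s≤s (a j q)
  Zeckendorf-inside z a (suc i) zero    (there p) _         _   = s≤s (a i p)
  Zeckendorf-inside z a (suc i) (suc j) (there p) (there q) i≢j =
    z i j p q (i≢j ∘ cong suc)

  Zeckendorf-inside⇒AtLeast : Zeckendorf (suc g) (inside ∷ S) → AtLeast g S
  Zeckendorf-inside⇒AtLeast z i p = s≤s⁻¹ (z zero (suc i) here (there p) λ ())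

Contains-tail : ∀ {m b} {S : Subset n} → Contains (suc (suc m)) (b ∷ S) → Contains (suc m) S
Contains-tail (suc i , there p , eq) = i , p , suc-injective eq

Contains-∷ : ∀ {m b} {S : Subset n} → Contains m S → Contains (suc m) (b ∷ S)
Contains-∷ (i , p , eq) = suc i , there p , cong suc eq

-- The conditions on the unread part of a counted set after its minimum: c absent
-- numbers and s elements must still follow. By the last conjunct the unread part
-- contains the largest number available, unless the range is exhausted (n = 0).
Above : (g c s : ℕ) → Subset n → Set
Above {n} g c s S =
  Zeckendorf (suc g) S × AtLeast c S × ∣ S ∣ ≡ s × Contains (suc n) (inside ∷ S)

above? : ∀ g c s → Decidable (Above {n} g c s)
above? {n} g c s S =
  zeckendorf? (suc g) S ×-dec atLeast? c S ×-dec ∣ S ∣ ≟ s ×-dec contains? (suc n) (inside ∷ S)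

-- The conditions on a counted set after z absent numbers have been read off.
From : (k z : ℕ) → Subset n → Set
From {n} k z S =
  Zeckendorf k S × Contains n S × ∃ λ i → IsMin i S × z + num i ≡ ∣ S ∣

from? : ∀ k z → Decidable (From {n} k z)
from? {n} k z S =
  zeckendorf? k S ×-dec contains? n S ×-dec Fin.any? λ i → isMin? i S ×-dec z + num i ≟ ∣ S ∣

module _ (g : ℕ) where

  above : (c s n : ℕ) → ℕ
  above c s n = count (above? {n} g c s)

  from : (z n : ℕ) → ℕ
  from z n = count (from? {n} (suc g) z)

  -- The positive size matters: with no elements left and `n = 0`, the prefixed `inside` satisfies
  -- the right side, but on the left an absent number follows it, so it is not the largest.
  Above-outside : ∀ c s → (Above {suc n} g c (suc s) ∘ (outside ∷_)) ≐ Above g (pred c) (suc s)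
  Above-outside c s = to , of
    where
    to : ∀ {S : Subset n} → Above g c (suc s) (outside ∷ S) → Above g (pred c) (suc s) S
    to (z , a , eq , (suc (suc i) , there (there p) , eq′)) =
      Zeckendorf-tail z , AtLeast-outside⁻ a , eq , suc i , there p , suc-injective eq′
    of : ∀ {S : Subset n} → Above g (pred c) (suc s) S → Above g c (suc s) (outside ∷ S)
    of {S = []} (_ , _ , () , _)
    of {S = _ ∷ _} (z , a , eq , (suc i , there p , eq′)) =
      Zeckendorf-outside z , AtLeast-outside⁺ a , eq , suc (suc i) , there (there p) , cong suc eq′

  -- The `inside` prefixed in `Above` stands for the last element read. For the tail this is the
  -- element just read, and the forced absences start again at `g`.
  Above-inside : ∀ s → (Above {suc n} g 0 (suc s) ∘ (inside ∷_)) ≐ Above g g s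
  Above-inside s =
      (λ (z , _ , eq , c) →
        Zeckendorf-tail z , Zeckendorf-inside⇒AtLeast z , suc-injective eq , Contains-tail c)
    , (λ (z , a , eq , c) →
        Zeckendorf-inside z a , (λ _ _ → z≤n) , cong suc eq , Contains-∷ c)

  From-outside : ∀ z → (From {suc n} (suc g) z ∘ (outside ∷_)) ≐ From (suc g) (suc z)
  From-outside z = to , of
    where
    to : ∀ {S : Subset n} → From (suc g) z (outside ∷ S) → From (suc g) (suc z) S
    to (ζ , (suc j , there q , eq′) , suc i , (there p , least) , eq) =
      Zeckendorf-tail ζ , (j , q , suc-injective eq′) , i ,
      (p , λ l r → s≤s⁻¹ (least (suc l) (there r))) , trans (sym (+-suc z (num i))) eq
    of : ∀ {S : Subset n} → From (suc g) (suc z) S → From (suc g) z (outside ∷ S)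
    of (ζ , c , i , (p , least) , eq) =
      Zeckendorf-outside ζ , Contains-∷ c , suc i ,
      (there p , λ { (suc l) (there r) → s≤s (least l r) }) , trans (+-suc z (num i)) eq

  From-inside : ∀ z → (From {suc n} (suc g) z ∘ (inside ∷_)) ≐ Above g g z
  From-inside z = to , of
    where
    to : ∀ {S : Subset n} → From (suc g) z (inside ∷ S) → Above g g z S
    to (ζ , c , zero , _ , eq) =
      Zeckendorf-tail ζ , Zeckendorf-inside⇒AtLeast ζ ,
      suc-injective (trans (sym eq) (+-comm z 1)) , c
    -- A later minimum would have to be at most 1, the number just read.
    to (ζ , c , suc i , (_ , least) , eq) = contradiction (least zero here) λ { (s≤s ()) }
    of : ∀ {S : Subset n} → Above g g z S → From (suc g) z (inside ∷ S)
    of (ζ , a , eq , c) =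
      Zeckendorf-inside ζ a , c , zero ,
      (here , λ _ _ → s≤s z≤n) , trans (+-comm z 1) (cong suc (sym eq))

  -- Boundary values and recurrences of the two counts.

  above-empty : above g 0 0 ≡ 1
  above-empty = cong length (filter-all (above? g g 0) {xs = subsets 0}
    -- Nothing is left to read, so the prefixed `inside` itself is the largest number.
    (((λ ()) , (λ ()) , refl , zero , here , refl) ∷ []))

  above-zero : ∀ c n → above c 0 (suc n) ≡ 0
  above-zero c n = count-none {n = suc n} (above? g c 0) λ S (_ , _ , eq , max) →
    let _ , p , _ = Contains-tail max in
    -- Deleting the largest number, which is present, would leave fewer than 0 elements.
    contradiction (≤-trans (x∈p⇒∣p-x∣<∣p∣ p) (≤-reflexive eq)) λ ()

  above-skip : ∀ c s n → above (suc c) (suc s) (suc n) ≡ above c (suc s) n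
  above-skip c s n = trans (count-∷ {n} (above? g (suc c) (suc s)))
    (trans (cong₂ _+_
      (count-cong {n} _ (above? g c (suc s)) (Above-outside (suc c) s))
      (count-none {n} (above? g (suc c) (suc s) ∘ (inside ∷_))
        λ _ (_ , a , _) → contradiction (a zero here) λ ()))
    (+-identityʳ _))

  above-suc : ∀ s n → above 0 (suc s) (suc n) ≡ above 0 (suc s) n + above g s n
  above-suc s n = trans (count-∷ {n} (above? g 0 (suc s))) (cong₂ _+_
    (count-cong {n} _ (above? g 0 (suc s)) (Above-outside 0 s))
    (count-cong {n} _ (above? g g s) (Above-inside s)))

  from-suc : ∀ z n → from z (suc n) ≡ from (suc z) n + above g z n
  from-suc z n = trans (count-∷ {n} (from? (suc g) z)) (cong₂ _+_
    (count-cong {n} _ (from? (suc g) (suc z)) (From-outside z))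
    (count-cong {n} _ (above? g g z) (From-inside z)))

  from-empty : ∀ z → from z 0 ≡ 0
  from-empty z = count-none {n = 0} (from? (suc g) z) λ { _ (_ , (() , _) , _) }

  above-+ : ∀ c s n → above c (suc s) (c + n) ≡ above 0 (suc s) n
  above-+ zero    s n = refl
  above-+ (suc c) s n = trans (above-skip c s (c + n)) (above-+ c s n)

  above-vanish : ∀ c s n → n ≤ c → above c (suc s) n ≡ 0
  above-vanish c s zero _ = count-none {n = 0} (above? g c (suc s)) λ { [] (_ , _ , () , _) }
  above-vanish (suc c) s (suc n) (s≤s n≤c) = trans (above-skip c s n) (above-vanish c s n n≤c)

  -- Strip the `g` forced absences. The number after them is either absent, and dropping it shortens
  -- the gap by one, or it is the next element, at distance exactly `suc g`.
  above-rec : ∀ s n → above g (suc s) (suc (g + n)) ≡ above g (suc s) (g + n) + above g s n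
  above-rec s n = begin
    above g (suc s) (suc (g + n))          ≡⟨ cong (above g (suc s)) (+-suc g n) ⟨
    above g (suc s) (g + suc n)            ≡⟨ above-+ g s (suc n) ⟩
    above 0 (suc s) (suc n)                ≡⟨ above-suc s n ⟩
    above 0 (suc s) n + above g s n        ≡⟨ cong (_+ above g s n) (above-+ g s n) ⟨
    above g (suc s) (g + n) + above g s n  ∎
    where open ≡-Reasoning

  -- After at least one absence the minimum exceeds 1, so a second element must follow it beyond `g`
  -- absent numbers; this does not fit into `suc g` places.
  from-vanish : ∀ z n → n ≤ suc g → from (suc z) n ≡ 0
  from-vanish z zero    _         = from-empty (suc z)
  from-vanish z (suc n) (s≤s n≤g) = trans (from-suc (suc z) n)
    (cong₂ _+_ (from-vanish (suc z) n (≤-trans n≤g (n≤1+n g))) (above-vanish g z n n≤g))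

  -- Induction on `n` with `z` free, since passing an absent number raises `z`. If the next number
  -- is the minimum, `above-rec` applies; otherwise the induction hypothesis at `suc z` does.
  -- Regrouping the four summands gives two `from` counts.
  from-rec : ∀ z n → from (suc z) (suc (suc g + n)) ≡ from (suc z) (suc g + n) + from z (suc n)
  from-rec z n = begin
    from (suc z) (suc (suc g + n))
      ≡⟨ from-suc (suc z) (suc g + n) ⟩
    from (suc (suc z)) (suc g + n) + above g (suc z) (suc g + n)
      ≡⟨ cong₂ _+_ (shifted n) (above-rec z n) ⟩
    (from (suc (suc z)) (g + n) + from (suc z) n) + (above g (suc z) (g + n) + above g z n)
      ≡⟨ interchange +-commutativeSemigroup (from (suc (suc z)) (g + n)) _ _ _ ⟩
    (from (suc (suc z)) (g + n) + above g (suc z) (g + n)) + (from (suc z) n + above g z n)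
      ≡⟨ cong₂ _+_ (from-suc (suc z) (g + n)) (from-suc z n) ⟨
    from (suc z) (suc g + n) + from z (suc n) ∎
    where
    open ≡-Reasoning
    shifted : ∀ n → from (suc (suc z)) (suc g + n) ≡ from (suc (suc z)) (g + n) + from (suc z) n
    -- The induction hypothesis would be needed one below 0; here all three counts vanish.
    shifted zero = begin
      from (suc (suc z)) (suc g + 0)
        ≡⟨ from-vanish (suc z) (suc g + 0) (≤-reflexive (+-identityʳ (suc g))) ⟩
      0
        ≡⟨ cong₂ _+_ (from-vanish (suc z) (g + 0)
             (≤-trans (≤-reflexive (+-identityʳ g)) (n≤1+n g))) (from-empty (suc z)) ⟨
      from (suc (suc z)) (g + 0) + from (suc z) 0 ∎
    shifted (suc n) = begin
      from (suc (suc z)) (suc g + suc n)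
        ≡⟨ cong (from (suc (suc z)) ∘ suc) (+-suc g n) ⟩
      from (suc (suc z)) (suc (suc g + n))
        ≡⟨ from-rec (suc z) n ⟩
      from (suc (suc z)) (suc g + n) + from (suc z) (suc n)
        ≡⟨ cong (λ m → from (suc (suc z)) m + from (suc z) (suc n)) (+-suc g n) ⟨
      from (suc (suc z)) (g + suc n) + from (suc z) (suc n) ∎

  -- Values and recurrence of `J`.

  J≡from : ∀ n → J (suc g) n ≡ from 0 n
  -- The predicates agree definitionally, as `0 + num i` reduces to `num i`.
  J≡from n = count-cong {n} (counted? (suc g) n) (from? (suc g) 0) (id , id)

  J-one : J (suc g) 1 ≡ 1
  J-one = trans (J≡from 1) (trans (from-suc 0 0) (cong₂ _+_ (from-empty 1) above-empty))

  -- A maximal set with minimum 1 is a singleton and misses the largest number here. So 1 is absent,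
  -- which brings the count into the range of `from-vanish` and `from-rec`.
  J-suc : ∀ n → J (suc g) (suc (suc n)) ≡ from 1 (suc n)
  J-suc n = trans (J≡from (suc (suc n))) (trans (from-suc 0 (suc n))
    (trans (cong (from 1 (suc n) +_) (above-zero g n)) (+-identityʳ _)))

  J-vanish : ∀ n → n ≤ g → J (suc g) (2 + n) ≡ 0
  J-vanish n n≤g = trans (J-suc n) (from-vanish 0 (suc n) (s≤s n≤g))

  J-rec : ∀ n → J (suc g) (3 + g + n) ≡ J (suc g) (2 + g + n) + J (suc g) (1 + n)
  J-rec n = trans (J-suc (suc g + n)) (trans (from-rec 0 n)
    (cong₂ _+_ (sym (J-suc (g + n))) (sym (J≡from (suc n)))))

  -- The value 1 enters once, as `J (suc g) 1`; every later step of the recurrence adds a term from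
  -- the range where `J` vanishes.
  J-plateau : ∀ n → n ≤ suc g → J (suc g) (3 + g + n) ≡ 1
  J-plateau zero _ = trans (J-rec 0)
    (cong₂ _+_ (J-vanish (g + 0) (≤-reflexive (+-identityʳ g))) J-one)
  J-plateau (suc n) (s≤s n≤g) = trans (J-rec (suc n)) (cong₂ _+_
    (trans (cong (J (suc g) ∘ (2 +_)) (+-suc g n)) (J-plateau n (≤-trans n≤g (n≤1+n g))))
    (J-vanish n n≤g))

theorem6 : ∀ (k : ℕ) → 2 ≤ k → ∀ (n : ℕ) → 1 ≤ n →
    (n ≡ 1 → J k n ≡ 1)
    × (2 ≤ n → n ≤ k + 1 → J k n ≡ 0)
    × (k + 1 < n → n ≤ 2 * k + 2 → J k n ≡ 1)
    × (2 * k + 2 < n → J k n ≡ J k (n ∸ 1) + J k (n ∸ (k + 1)))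
theorem6 k@(suc g) _ n _ = one , vanish , plateau , recurrence
  where
  one : n ≡ 1 → J k n ≡ 1
  one refl = J-one g

  vanish : 2 ≤ n → n ≤ k + 1 → J k n ≡ 0
  vanish (s≤s (s≤s {n = m} _)) n≤k+1 =
    J-vanish g m (s≤s⁻¹ (s≤s⁻¹ (≤-trans n≤k+1 (≤-reflexive (+-comm k 1)))))

  -- `3 + g` is k + 2, the least `n` allowed.
  offset : k + 1 < n → ∃ λ m → n ≡ 3 + g + m
  offset k+1<n = n ∸ (3 + g) ,
    sym (m+[n∸m]≡n (subst (_< n) (+-comm k 1) k+1<n))

  plateau : k + 1 < n → n ≤ 2 * k + 2 → J k n ≡ 1
  plateau k+1<n n≤2k+2 with m , refl ← offset k+1<n =
    -- As 2k + 2 = (k + 2) + k, the upper bound on `n` becomes m ≤ k.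
    J-plateau g m (+-cancelˡ-≤ (3 + g) m k (≤-trans n≤2k+2 (≤-reflexive 2k+2≡)))
    where
    open +-*-Solver
    2k+2≡ : 2 * k + 2 ≡ 3 + g + k
    2k+2≡ = solve 1 (λ g → con 2 :* (con 1 :+ g) :+ con 2 := con 3 :+ g :+ (con 1 :+ g)) refl g

  k+1≤2k+2 : k + 1 ≤ 2 * k + 2
  k+1≤2k+2 = +-mono-≤ (m≤m+n k (k + 0)) (n≤1+n 1)

  recurrence : 2 * k + 2 < n → J k n ≡ J k (n ∸ 1) + J k (n ∸ (k + 1))
  recurrence 2k+2<n with m , refl ← offset (≤-<-trans k+1≤2k+2 2k+2<n) =
    trans (J-rec g m) (cong (λ l → J k (2 + g + m) + J k l) (sym 3+g+m∸[k+1]≡1+m))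
    where
    3+g+m∸[k+1]≡1+m : 3 + g + m ∸ (k + 1) ≡ 1 + m
    3+g+m∸[k+1]≡1+m = trans
      (cong₂ _∸_ (sym (+-suc (2 + g) m)) (+-comm k 1))
      (m+n∸m≡n (2 + g) (suc m))
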